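{- Let $t\ge1$, fix distinct positive integers $\ell_1,\dots,\ell_t$, and let $H'=\{A\subseteq[n]: |A|\text{ is odd}\}$. There exists a threshold $n_0=n_0(\ell_1,\dots,\ell_t)$ such that, for all $n\ge n_0$, any family $\mathcal F\subseteq H'$ satisfying $|A\triangle B|\in\{2\ell_1,\dots,2\ell_t\}$ for all distinct $A,B\in\mathcal F$ obeys the bound $$|\mathcal F|\le \sum_{i=0}^{t}\binom{n-1}{i}.$$ Moreover, this bound is sharp for the distance set $\{2,4,\dots,2t\}$: for $\ell_j=j$ ($1\le j\le t$) and all $n\ge n_0(1,\dots,t)$ there is such a family $\mathcal F\subseteq H'$ with $|\mathcal F|=\sum_{i=0}^{t}\binom{n-1}{i}$.
   Context: Here $[n]=\{1,\dots,n\}$ and $\triangle$ denotes symmetric difference of sets. The set $H'$ is called the odd subcube. -}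

module Defs where

open import Data.Fin using (Fin)
open import Data.Fin.Subset using (Subset; _∪_; _─_; ∣_∣)
open import Data.List using (List; length; map; sum; upTo)
open import Data.List.Membership.Propositional using (_∈_)
open import Data.List.Relation.Unary.All using (All)
open import Data.List.Relation.Unary.Unique.Propositional using (Unique)
open import Data.Nat using (ℕ; suc; _*_; _∸_; parity)
open import Data.Nat.Combinatorics using (_C_)
open import Data.Parity.Base using (1ℙ)
open import Data.Product using (∃-syntax)
open import Relation.Binary.PropositionalEquality using (_≡_; _≢_)

private
  variable
    n t : ℕ

-- The ground set [n] = {1,…,n} is modelled by Fin n.

infixl 5 _△_

_△_ : Subset n → Subset n → Subset n
A △ B = (A ─ B) ∪ (B ─ A)

OddSubcube : Subset n → Set
OddSubcube A = parity ∣ A ∣ ≡ 1ℙ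

-- A finite set of subsets of [n], enumerated without repetition, so that
-- the length of the enumeration is the cardinality of the set.
record Family (n : ℕ) : Set where
  constructor family
  field
    members : List (Subset n)
    unique  : Unique members

open Family public

card : Family n → ℕ
card F = length (members F)

_⊆ᶠ_ : Family n → (Subset n → Set) → Set
F ⊆ᶠ P = All P (members F)

-- Symmetric differences of distinct members have size in {2ℓ₁,…,2ℓₜ}.
HasDistances2 : (Fin t → ℕ) → Family n → Set
HasDistances2 ℓ F =
  ∀ A B → A ∈ members F → B ∈ members F → A ≢ B → ∃[ j ] ∣ A △ B ∣ ≡ 2 * ℓ j

-- Σ_{i=0}^{t} C(n-1, i).  Truncated subtraction departs from n-1 only at
-- n = 0, which the threshold on n may exclude.
bound : ℕ → ℕ → ℕ
bound n t = sum (map (λ i → (n ∸ 1) C i) (upTo (suc t)))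

{-# OPTIONS --safe #-}
module Submission where

-- Upper bound, by an inertia argument.  Let s(A,B) = n - 2|A △ B| = Σₖ χ_{k}(A) χ_{k}(B).
-- The polynomial p(s) = ∏ⱼ (s - (n - 4ℓⱼ)) vanishes at s(A,B) for distinct A, B in F, and
-- p(n) > 0.  As soon as every root n - 4ℓⱼ is nonnegative, the coefficient of
-- χ_S(A) χ_S(B) in p(s(A,B)) has sign (-1)^(t-|S|), and it is zero for |S| > t.
-- Only S with |S| ≤ t and |S| ≡ t mod 2 contribute positively; dropping one coordinate
-- identifies these S with the subsets of [n-1] of size at most t.  If F had more members,
-- a nonzero integer vector u on F would be orthogonal to all those χ_S, and
-- p(n) Σ u² = Σ_{A,B} u_A u_B p(s(A,B)) ≤ 0, a contradiction.
--
-- Sharpness: the ball of radius t in the cube on [n-1] has diameter at most 2t, and adding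
-- a parity bit makes all its members odd and all distances even.

open import Defs
open import Algebra.Properties.Semiring.Sum as SemiringSum using ()
open import Data.Bool using (not)
open import Data.Fin as Fin using (Fin; zero; suc; toℕ; punchIn; punchOut; fromℕ<)
open import Data.Fin.Properties using (any?; punchInᵢ≢i; punchIn-punchOut; toℕ-fromℕ<)
open import Data.Fin.Subset using (Subset; Side; inside; outside; ∣_∣; ⊥)
open import Data.Fin.Subset.Properties using (∣⊥∣≡0; ∣p∣≤∣x∷p∣)
open import Data.Integer as ℤ using (ℤ; +_; 0ℤ; 1ℤ; -1ℤ; _+_; _-_; _*_; -_)
import Data.Integer.Properties as ℤ
open import Data.Integer.Tactic.RingSolver using (solve-∀)
open import Data.List
  using (List; []; _∷_; [_]; _++_; length; map; concatMap; upTo; tabulate; lookup)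
import Data.List.Extrema.Nat as Extrema
open import Data.List.Membership.Propositional using (_∈_)
open import Data.List.Membership.Propositional.Properties
  using (∈-++⁺ˡ; ∈-++⁺ʳ; ∈-map⁺; ∈-map⁻; ∈-lookup; ∈-tabulate⁺; ∈-upTo⁺; ∈-concatMap⁺)
open import Data.List.Properties using (length-++; length-map; length-tabulate)
open import Data.List.Relation.Unary.All as All using (All; []; _∷_)
import Data.List.Relation.Unary.All.Properties as All
open import Data.List.Relation.Unary.AllPairs as AllPairs using ([]; _∷_)
import Data.List.Relation.Unary.AllPairs.Properties as AllPairs
open import Data.List.Relation.Unary.Any as Any using (here; there; index)
open import Data.List.Relation.Unary.Any.Properties using (lookup-index)
open import Data.List.Relation.Unary.Unique.Propositional using (Unique)
import Data.List.Relation.Unary.Unique.Propositional.Properties as Unique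
open import Data.Nat as ℕ using (ℕ; zero; suc; _≤_; _≥_; _>_; z≤n; s≤s; parity)
open import Data.Nat.Combinatorics using (_C_; nCk+nC[k+1]≡[n+1]C[k+1])
open import Data.Nat.ListAction using (sum)
import Data.Nat.Properties as ℕ
open import Data.Parity.Base as ℙ using (Parity; 0ℙ; 1ℙ; _⁻¹)
import Data.Parity.Properties as ℙ
open import Data.Product using (∃-syntax; Σ-syntax; _×_; _,_; proj₁; proj₂)
open import Data.Sum using (_⊎_; inj₁; inj₂; [_,_]′)
open import Data.Vec as Vec using ([]; _∷_; _[_]%=_)
open import Data.Vec.Properties using (∷-injectiveʳ)
open import Function using (_∘_; case_of_)
open import Function.Definitions using (Injective)
open import Relation.Binary.PropositionalEquality hiding ([_])
open import Relation.Nullary using (¬_; yes; no; contradiction)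
open import Relation.Nullary.Decidable using (¬?; decidable-stable)

open SemiringSum ℤ.+-*-semiring
  using (∑-distrib-+; *-distribˡ-sum; *-distribʳ-sum; sum-cong-≗; sum-remove)
  renaming (sum to ∑; sum-syntax to ∑-syntax)

private
  variable
    m n r t : ℕ

-- Integer kernel vectors of underdetermined linear systems.

∑-zero : {f : Fin m → ℤ} → (∀ i → f i ≡ 0ℤ) → ∑ f ≡ 0ℤ
∑-zero {zero}  f≡0 = refl
∑-zero {suc m} f≡0 = cong₂ _+_ (f≡0 zero) (∑-zero (f≡0 ∘ suc))

-- Gaussian elimination of the first unknown, kept free of fractions by cross-multiplication.
kernelVector : r ℕ.< m → (M : Fin r → Fin m → ℤ) →
  Σ[ u ∈ (Fin m → ℤ) ] (∃[ j ] u j ≢ 0ℤ) × (∀ i → ∑[ j < m ] (M i j * u j) ≡ 0ℤ)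
kernelVector {r} {suc m} r<m M with any? (λ i → ¬? (M i zero ℤ.≟ 0ℤ))
-- If the first column vanishes, the first unit vector already solves the system.
... | no  allZero = e₀ , (zero , λ ()) , λ i →
        cong₂ _+_ (trans (ℤ.*-identityʳ _) (decidable-stable (_ ℤ.≟ _) (λ ≢0 → allZero (i , ≢0))))
                  (∑-zero (λ j → ℤ.*-zeroʳ (M i (suc j))))
  where
  e₀ : Fin (suc m) → ℤ
  e₀ zero    = 1ℤ
  e₀ (suc _) = 0ℤ
kernelVector {suc r} {suc m} (s≤s r<m) M | yes (p , c≢0) = u , (suc k , uₖ≢0) , solves
  where
  c = M p zero

  reduced : Fin r → Fin m → ℤ
  reduced i j = c * M (punchIn p i) (suc j) - M (punchIn p i) zero * M p (suc j)

  ih = kernelVector r<m reduced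
  v = proj₁ ih
  k = proj₁ (proj₁ (proj₂ ih))
  vₖ≢0 = proj₂ (proj₁ (proj₂ ih))

  -- Back substitution without division: scaling the reduced solution `v` by the pivot `c` makes the
  -- first unknown, read off from row `p`, an integer.
  u : Fin (suc m) → ℤ
  u zero    = - (∑[ j < m ] (M p (suc j) * v j))
  u (suc j) = c * v j

  uₖ≢0 : c * v k ≢ 0ℤ
  uₖ≢0 eq = [ c≢0 , vₖ≢0 ]′ (ℤ.i*j≡0⇒i≡0∨j≡0 c eq)

  -- One identity serves all rows: for the pivot row the right-hand side cancels termwise, for any
  -- other row it is an equation of the reduced system.
  row : ∀ i → ∑[ j < suc m ] (M i j * u j) ≡
              ∑[ j < m ] ((c * M i (suc j) - M i zero * M p (suc j)) * v j)
  row i = begin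
    a * - ∑ f + ∑[ j < m ] (M i (suc j) * (c * v j))
      ≡⟨ cong (λ s → s + ∑[ j < m ] (M i (suc j) * (c * v j))) (trans (reassoc a (∑ f)) (*-distribˡ-sum (- a) f)) ⟩
    ∑[ j < m ] (- a * f j) + ∑[ j < m ] (M i (suc j) * (c * v j))
      ≡⟨ ∑-distrib-+ (λ j → - a * f j) _ ⟨
    ∑[ j < m ] (- a * f j + M i (suc j) * (c * v j))
      ≡⟨ sum-cong-≗ (λ j → regroup a (M p (suc j)) (M i (suc j)) c (v j)) ⟩
    ∑[ j < m ] ((c * M i (suc j) - a * M p (suc j)) * v j) ∎
    where
    open ≡-Reasoning
    a = M i zero
    f = λ j → M p (suc j) * v j
    reassoc : ∀ a x → a * - x ≡ - a * x
    reassoc = solve-∀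
    regroup : ∀ a b d c v → - a * (b * v) + d * (c * v) ≡ (c * d - a * b) * v
    regroup = solve-∀

  pivotCancels : ∀ c b v → (c * b - c * b) * v ≡ 0ℤ
  pivotCancels = solve-∀

  solves : ∀ i → ∑[ j < suc m ] (M i j * u j) ≡ 0ℤ
  solves i with p Fin.≟ i
  ... | yes refl = trans (row p) (∑-zero (λ j → pivotCancels c (M p (suc j)) (v j)))
  ... | no  p≢i  = trans (row i)
    (subst (λ i → ∑[ j < m ] ((c * M i (suc j) - M i zero * M p (suc j)) * v j) ≡ 0ℤ)
           (punchIn-punchOut p≢i)
           (proj₂ (proj₂ ih) (punchOut p≢i)))

-- Signs of integer sums and of sums of squares.

∑-single : (i : Fin m) (f : Fin m → ℤ) → (∀ j → j ≢ i → f j ≡ 0ℤ) → ∑ f ≡ f i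
∑-single {suc m} i f off = begin
  ∑ f                         ≡⟨ sum-remove {i = i} f ⟩
  f i + ∑ (f ∘ punchIn i)     ≡⟨ cong (λ s → f i + s) (∑-zero (λ j → off _ (punchInᵢ≢i i j))) ⟩
  f i + 0ℤ                    ≡⟨ ℤ.+-identityʳ (f i) ⟩
  f i                         ∎
  where open ≡-Reasoning

∑-nonNeg : (f : Fin m → ℤ) → (∀ i → 0ℤ ℤ.≤ f i) → 0ℤ ℤ.≤ ∑ f
∑-nonNeg {zero}  f f≥0 = ℤ.≤-refl
∑-nonNeg {suc m} f f≥0 = ℤ.+-mono-≤ (f≥0 zero) (∑-nonNeg (f ∘ suc) (f≥0 ∘ suc))

∑-nonPos : (f : Fin m → ℤ) → (∀ i → f i ℤ.≤ 0ℤ) → ∑ f ℤ.≤ 0ℤ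
∑-nonPos {zero}  f f≤0 = ℤ.≤-refl
∑-nonPos {suc m} f f≤0 = ℤ.+-mono-≤ (f≤0 zero) (∑-nonPos (f ∘ suc) (f≤0 ∘ suc))

square-nonNeg : ∀ i → 0ℤ ℤ.≤ i * i
square-nonNeg (+ zero)       = ℤ.≤-refl
square-nonNeg (+ suc _)      = ℤ.+≤+ z≤n
square-nonNeg ℤ.-[1+ _ ]     = ℤ.+≤+ z≤n

square-pos : ∀ {i} → i ≢ 0ℤ → 0ℤ ℤ.< i * i
square-pos {i} i≢0 = ℤ.≤∧≢⇒< (square-nonNeg i)
  (λ eq → [ i≢0 , i≢0 ]′ (ℤ.i*j≡0⇒i≡0∨j≡0 i (sym eq)))

∑-squares-pos : (u : Fin m → ℤ) → ∀ {k} → u k ≢ 0ℤ → 0ℤ ℤ.< ∑[ i < m ] (u i * u i)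
∑-squares-pos {suc m} u {k} uₖ≢0 =
  subst (0ℤ ℤ.<_) (sym (sum-remove {i = k} (λ i → u i * u i)))
    (ℤ.+-mono-<-≤ (square-pos uₖ≢0) (∑-nonNeg _ (λ i → square-nonNeg (u (punchIn k i)))))

-- Quadratic forms evaluated at a fixed vector.

module QuadraticForm (u : Fin m → ℤ) where

  form : (Fin m → Fin m → ℤ) → ℤ
  form f = ∑[ i < m ] ∑[ j < m ] (u i * u j * f i j)

  form-cong : ∀ {f g} → (∀ i j → f i j ≡ g i j) → form f ≡ form g
  form-cong f≗g = sum-cong-≗ (λ i → sum-cong-≗ (λ j → cong (u i * u j *_) (f≗g i j)))

  form-+ : ∀ f g → form (λ i j → f i j + g i j) ≡ form f + form g
  form-+ f g = trans
    (sum-cong-≗ (λ i → trans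
      (sum-cong-≗ (λ j → ℤ.*-distribˡ-+ (u i * u j) (f i j) (g i j)))
      (∑-distrib-+ (λ j → u i * u j * f i j) _)))
    (∑-distrib-+ (λ i → ∑[ j < m ] (u i * u j * f i j)) _)

  form-* : ∀ c f → form (λ i j → c * f i j) ≡ c * form f
  form-* c f = sym (trans (*-distribˡ-sum c (λ i → ∑[ j < m ] (u i * u j * f i j)))
    (sum-cong-≗ (λ i → trans (*-distribˡ-sum c (λ j → u i * u j * f i j))
      (sum-cong-≗ (λ j → swap c (u i * u j) (f i j))))))
    where
    swap : ∀ c a b → c * (a * b) ≡ a * (c * b)
    swap = solve-∀

  form-∑ : (f : Fin n → Fin m → Fin m → ℤ) →
           form (λ i j → ∑[ k < n ] f k i j) ≡ ∑[ k < n ] form (f k)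
  form-∑ {zero}  f = ∑-zero (λ i → ∑-zero (λ j → ℤ.*-zeroʳ (u i * u j)))
  form-∑ {suc n} f = trans (form-+ (f zero) _) (cong (λ s → form (f zero) + s) (form-∑ (f ∘ suc)))

  -- A rank-one form is the square of a linear functional. Every sign below comes from this: the
  -- value is never negative, and it is zero when `u` is orthogonal to `φ`.
  form-⊗ : (φ : Fin m → ℤ) → let l = ∑[ i < m ] (φ i * u i) in form (λ i j → φ i * φ j) ≡ l * l
  form-⊗ φ = sym (trans (*-distribʳ-sum l (λ i → φ i * u i))
    (sum-cong-≗ (λ i → trans (*-distribˡ-sum (φ i * u i) (λ j → φ j * u j))
      (sum-cong-≗ (λ j → interchange (φ i) (u i) (φ j) (u j))))))
    where
    l = ∑[ i < m ] (φ i * u i)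
    interchange : ∀ a b c d → a * b * (c * d) ≡ b * d * (a * c)
    interchange = solve-∀

  form-diagonal : ∀ {f c} → (∀ i → f i i ≡ c) → (∀ i j → j ≢ i → f i j ≡ 0ℤ) →
                  form f ≡ c * ∑[ i < m ] (u i * u i)
  form-diagonal {f} {c} diag off = begin
    form f                      ≡⟨ sum-cong-≗ row ⟩
    ∑[ i < m ] (c * (u i * u i)) ≡⟨ *-distribˡ-sum c (λ i → u i * u i) ⟨
    c * ∑[ i < m ] (u i * u i)  ∎
    where
    open ≡-Reasoning
    row : ∀ i → ∑[ j < m ] (u i * u j * f i j) ≡ c * (u i * u i)
    row i = begin
      ∑[ j < m ] (u i * u j * f i j)
        ≡⟨ ∑-single i _ (λ j j≢i → trans (cong (u i * u j *_) (off i j j≢i)) (ℤ.*-zeroʳ (u i * u j))) ⟩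
      u i * u i * f i i  ≡⟨ cong (u i * u i *_) (diag i) ⟩
      u i * u i * c      ≡⟨ ℤ.*-comm (u i * u i) c ⟩
      c * (u i * u i)    ∎

-- Characters of the cube and flips of their index sets.

sgn : Side → ℤ
sgn outside = 1ℤ
sgn inside  = -1ℤ

-- χ S A = (-1)^|S ∩ A|.
χ : Subset n → Subset n → ℤ
χ []            []      = 1ℤ
χ (outside ∷ S) (_ ∷ A) = χ S A
χ (inside  ∷ S) (a ∷ A) = sgn a * χ S A

flip : Subset n → Fin n → Subset n
flip S k = S [ k ]%= not

χ-⊥ : (A : Subset n) → χ ⊥ A ≡ 1ℤ
χ-⊥ []      = refl
χ-⊥ (_ ∷ A) = χ-⊥ A

-- Characters multiply by symmetric difference of their index sets, here with a singleton; the sign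
-- of `A` at `k` is the character of that singleton.
χ-flip : ∀ (S : Subset n) k A → χ (flip S k) A ≡ sgn (Vec.lookup A k) * χ S A
χ-flip (outside ∷ S) zero    (a ∷ A)       = refl
χ-flip (inside  ∷ S) zero    (outside ∷ A) = sym (trans (ℤ.*-identityˡ _) (ℤ.*-identityˡ _))
χ-flip (inside  ∷ S) zero    (inside  ∷ A) = involutive (χ S A)
  where
  involutive : ∀ x → x ≡ -1ℤ * (-1ℤ * x)
  involutive = solve-∀
χ-flip (outside ∷ S) (suc k) (a ∷ A)       = χ-flip S k A
χ-flip (inside  ∷ S) (suc k) (a ∷ A)       =
  trans (cong (sgn a *_) (χ-flip S k A)) (swap (sgn a) (sgn (Vec.lookup A k)) (χ S A))
  where
  swap : ∀ a b x → a * (b * x) ≡ b * (a * x)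
  swap = solve-∀

∣flip∣ : ∀ (S : Subset n) k → ∣ flip S k ∣ ≡ suc ∣ S ∣ ⊎ ∣ S ∣ ≡ suc ∣ flip S k ∣
∣flip∣ (outside ∷ S) zero    = inj₁ refl
∣flip∣ (inside  ∷ S) zero    = inj₂ refl
∣flip∣ (outside ∷ S) (suc k) = ∣flip∣ S k
∣flip∣ (inside  ∷ S) (suc k) = [ inj₁ ∘ cong suc , inj₂ ∘ cong suc ]′ (∣flip∣ S k)

-- Here `i` counts the factors still to be expanded. Spending one factor on a flip changes the total
-- of size and remaining factors by 0 or by -2, so it never grows and, as the next lemma records,
-- keeps its parity.
∣flip∣-≤ : ∀ (S : Subset n) k i → ∣ flip S k ∣ ℕ.+ i ≤ ∣ S ∣ ℕ.+ suc i
∣flip∣-≤ S k i rewrite ℕ.+-suc ∣ S ∣ i with ∣flip∣ S k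
... | inj₁ eq = ℕ.≤-reflexive (cong (ℕ._+ i) eq)
... | inj₂ eq rewrite eq = ℕ.m≤n+m _ 2

∣flip∣-parity : ∀ (S : Subset n) k i → parity (∣ flip S k ∣ ℕ.+ i) ≡ parity (∣ S ∣ ℕ.+ suc i)
∣flip∣-parity S k i rewrite ℕ.+-suc ∣ S ∣ i with ∣flip∣ S k
... | inj₁ eq = cong (λ s → parity (s ℕ.+ i)) eq
... | inj₂ eq rewrite eq = refl

parity-suc : ∀ k → parity (suc k) ≡ parity k ⁻¹
parity-suc k = trans (sym (ℙ.⁻¹-involutive _)) (cong _⁻¹ (ℙ.suc-homo-⁻¹ k))

-- The quantity s(A,B) of the overview, as the inner product of two sign vectors: in this form,
-- multiplying by it is a sum over single-coordinate flips.
corr : Subset n → Subset n → ℤ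
corr {n} A B = ∑[ k < n ] (sgn (Vec.lookup A k) * sgn (Vec.lookup B k))

corr-△ : (A B : Subset n) → corr A B ≡ + n - + 2 * + ∣ A △ B ∣
corr-△ []      []      = refl
corr-△ {suc n} (a ∷ A) (b ∷ B) = trans (cong (λ s → sgn a * sgn b + s) (corr-△ A B)) (step a b)
  where
  d = ∣ A △ B ∣
  agree : ∀ n d → 1ℤ + (n - + 2 * d) ≡ (1ℤ + n) - + 2 * d
  agree = solve-∀
  differ : ∀ n d → -1ℤ + (n - + 2 * d) ≡ (1ℤ + n) - + 2 * (1ℤ + d)
  differ = solve-∀
  step : ∀ a b → sgn a * sgn b + (+ n - + 2 * + d) ≡ + suc n - + 2 * + ∣ (a ∷ A) △ (b ∷ B) ∣
  step outside outside = agree (+ n) (+ d)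
  step outside inside  = differ (+ n) (+ d)
  step inside  outside = differ (+ n) (+ d)
  step inside  inside  = agree (+ n) (+ d)

-- Sign alternation for polynomials in the correlation whose roots are natural numbers.

monicWithRoots : List ℕ → ℤ → ℤ
monicWithRoots []       s = 1ℤ
monicWithRoots (a ∷ as) s = (s - + a) * monicWithRoots as s

module Alternation
  (x : Fin m → Subset n) (u : Fin m → ℤ)
  (orthogonal : ∀ S → ∣ S ∣ ≤ t → parity ∣ S ∣ ≡ parity t → ∑[ i < m ] (χ S (x i) * u i) ≡ 0ℤ)
  where

  open QuadraticForm u

  -- The coefficients of the polynomial in the character basis are never computed. Carrying a
  -- character factor instead makes the claim general enough for an induction that removes one root
  -- at a time; the index `⊥` gives back the polynomial itself.
  twisted : Subset n → List ℕ → Fin m → Fin m → ℤ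
  twisted S as i j = χ S (x i) * χ S (x j) * monicWithRoots as (corr (x i) (x j))

  twistedForm : Subset n → List ℕ → ℤ
  twistedForm S as = form (twisted S as)

  twistedForm-[] : ∀ S → let l = ∑[ i < m ] (χ S (x i) * u i) in twistedForm S [] ≡ l * l
  twistedForm-[] S = trans (form-cong (λ i j → ℤ.*-identityʳ (χ S (x i) * χ S (x j))))
                           (form-⊗ (χ S ∘ x))

  -- In the summand for `k`, the sign of `A` is absorbed into one character and the sign of `B` into
  -- the other. Multiplication by the correlation thus acts on the index `S` as the adjacency
  -- operator of the cube.
  corr-* : ∀ S A B y → corr A B * (χ S A * χ S B * y) ≡
                       ∑[ k < n ] (χ (flip S k) A * χ (flip S k) B * y)
  corr-* S A B y = trans
    (*-distribʳ-sum (χ S A * χ S B * y) (λ k → sgn (Vec.lookup A k) * sgn (Vec.lookup B k)))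
    (sum-cong-≗ (λ k → trans
      (regroup (sgn (Vec.lookup A k)) (sgn (Vec.lookup B k)) (χ S A) (χ S B) y)
      (sym (cong₂ (λ p q → p * q * y) (χ-flip S k A) (χ-flip S k B)))))
    where
    regroup : ∀ a b p q y → a * b * (p * q * y) ≡ a * p * (b * q) * y
    regroup = solve-∀

  twistedForm-∷ : ∀ S a as → twistedForm S (a ∷ as) ≡
                  ∑[ k < n ] twistedForm (flip S k) as + - + a * twistedForm S as
  twistedForm-∷ S a as = begin
    twistedForm S (a ∷ as)
      ≡⟨ form-cong (λ i j → trans
           (expand (χ S (x i) * χ S (x j)) (corr (x i) (x j)) (+ a) (monicWithRoots as (corr (x i) (x j))))
           (cong (λ s → s + - + a * twisted S as i j) (corr-* S (x i) (x j) _))) ⟩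
    form (λ i j → ∑[ k < n ] twisted (flip S k) as i j + - + a * twisted S as i j)
      ≡⟨ form-+ (λ i j → ∑[ k < n ] twisted (flip S k) as i j) (λ i j → - + a * twisted S as i j) ⟩
    form (λ i j → ∑[ k < n ] twisted (flip S k) as i j) + form (λ i j → - + a * twisted S as i j)
      ≡⟨ cong₂ _+_ (form-∑ (λ k → twisted (flip S k) as)) (form-* (- + a) (twisted S as)) ⟩
    ∑[ k < n ] twistedForm (flip S k) as + - + a * twistedForm S as ∎
    where
    open ≡-Reasoning
    expand : ∀ p s a y → p * ((s - a) * y) ≡ s * (p * y) + - a * (p * y)
    expand = solve-∀

  -- Each factor s - a either multiplies χ_S by s, which flips one coordinate and so the
  -- parity of |S|, or multiplies by -a ≤ 0.  The parity of |S| + length as therefore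
  -- decides the sign.
  mutual
    twistedForm-nonPos : ∀ as S → ∣ S ∣ ℕ.+ length as ≤ t →
      parity (∣ S ∣ ℕ.+ length as) ≡ parity t → twistedForm S as ℤ.≤ 0ℤ
    -- With no factor left, `S` has size at most `t` and the parity of `t`, so the functional itself
    -- vanishes. In the opposite parity its square is still nonnegative.
    twistedForm-nonPos [] S S≤t S≡t rewrite ℕ.+-identityʳ ∣ S ∣ =
      ℤ.≤-reflexive (trans (twistedForm-[] S) (cong (λ l → l * l) (orthogonal S S≤t S≡t)))
    twistedForm-nonPos (a ∷ as) S S≤t S≡t = subst (ℤ._≤ 0ℤ) (sym (twistedForm-∷ S a as))
      (ℤ.+-mono-≤
        (∑-nonPos _ (λ k → twistedForm-nonPos as (flip S k)
          (ℕ.≤-trans (∣flip∣-≤ S k (length as)) S≤t)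
          (trans (∣flip∣-parity S k (length as)) S≡t)))
        (-a*-nonPos (twistedForm-nonNeg as S
          (ℕ.≤-trans (ℕ.+-monoʳ-≤ ∣ S ∣ (ℕ.n≤1+n _)) S≤t)
          (trans (cong parity (sym (ℕ.+-suc ∣ S ∣ (length as)))) S≡t))))
      where
      -a*-nonPos : ∀ {y} → 0ℤ ℤ.≤ y → - + a * y ℤ.≤ 0ℤ
      -a*-nonPos y≥0 = subst₂ ℤ._≤_ (ℤ.neg-distribˡ-* (+ a) _) (cong -_ (ℤ.*-zeroʳ (+ a)))
        (ℤ.neg-mono-≤ (ℤ.*-monoˡ-≤-nonNeg (+ a) y≥0))

    twistedForm-nonNeg : ∀ as S → ∣ S ∣ ℕ.+ length as ≤ t →
      parity (suc (∣ S ∣ ℕ.+ length as)) ≡ parity t → 0ℤ ℤ.≤ twistedForm S as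
    twistedForm-nonNeg [] S _ _ = subst (0ℤ ℤ.≤_) (sym (twistedForm-[] S)) (square-nonNeg (∑[ i < m ] (χ S (x i) * u i)))
    twistedForm-nonNeg (a ∷ as) S S≤t S≢t = subst (0ℤ ℤ.≤_) (sym (twistedForm-∷ S a as))
      (ℤ.+-mono-≤
        (∑-nonNeg _ (λ k → twistedForm-nonNeg as (flip S k)
          (ℕ.≤-trans (∣flip∣-≤ S k (length as)) S≤t)
          (trans (parity-suc (∣ flip S k ∣ ℕ.+ length as))
            (trans (cong _⁻¹ (∣flip∣-parity S k (length as)))
              (trans (sym (parity-suc (∣ S ∣ ℕ.+ suc (length as)))) S≢t)))))
        (-a*-nonNeg (twistedForm-nonPos as S
          (ℕ.≤-trans (ℕ.+-monoʳ-≤ ∣ S ∣ (ℕ.n≤1+n _)) S≤t)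
          (trans (cong (parity ∘ suc) (sym (ℕ.+-suc ∣ S ∣ (length as)))) S≢t))))
      where
      -a*-nonNeg : ∀ {y} → y ℤ.≤ 0ℤ → 0ℤ ℤ.≤ - + a * y
      -a*-nonNeg y≤0 = subst₂ ℤ._≤_ (cong -_ (ℤ.*-zeroʳ (+ a))) (ℤ.neg-distribˡ-* (+ a) _)
        (ℤ.neg-mono-≤ (ℤ.*-monoˡ-≤-nonNeg (+ a) y≤0))

-- Enumeration of layers and balls of the cube.

layer : ∀ m → ℕ → List (Subset m)
layer zero    zero    = [ [] ]
layer zero    (suc i) = []
layer (suc m) zero    = map (outside ∷_) (layer m zero)
layer (suc m) (suc i) = map (inside ∷_) (layer m i) ++ map (outside ∷_) (layer m (suc i))

length-layer : ∀ m i → length (layer m i) ≡ m C i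
length-layer zero    zero    = refl
length-layer zero    (suc i) = refl
length-layer (suc m) zero    = trans (length-map _ (layer m zero)) (length-layer m zero)
length-layer (suc m) (suc i) = begin
  length (map (inside ∷_) (layer m i) ++ map (outside ∷_) (layer m (suc i)))
    ≡⟨ length-++ (map (inside ∷_) (layer m i)) ⟩
  length (map (inside ∷_) (layer m i)) ℕ.+ length (map (outside ∷_) (layer m (suc i)))
    ≡⟨ cong₂ ℕ._+_ (length-map _ (layer m i)) (length-map _ (layer m (suc i))) ⟩
  length (layer m i) ℕ.+ length (layer m (suc i))
    ≡⟨ cong₂ ℕ._+_ (length-layer m i) (length-layer m (suc i)) ⟩
  m C i ℕ.+ m C suc i
    ≡⟨ nCk+nC[k+1]≡[n+1]C[k+1] m i ⟩
  suc m C suc i ∎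
  where open ≡-Reasoning

∈-layer⁺ : ∀ (S : Subset m) {i} → ∣ S ∣ ≡ i → S ∈ layer m i
∈-layer⁺ []                    refl = here refl
∈-layer⁺ (inside  ∷ S)         refl = ∈-++⁺ˡ (∈-map⁺ (inside ∷_) (∈-layer⁺ S refl))
∈-layer⁺ (outside ∷ S) {zero}  eq   = ∈-map⁺ (outside ∷_) (∈-layer⁺ S eq)
∈-layer⁺ (outside ∷ S) {suc i} eq   = ∈-++⁺ʳ _ (∈-map⁺ (outside ∷_) (∈-layer⁺ S eq))

layer-size : ∀ m i → All (λ S → ∣ S ∣ ≡ i) (layer m i)
layer-size zero    zero    = refl ∷ []
layer-size zero    (suc i) = []
layer-size (suc m) zero    = All.map⁺ (layer-size m zero)
layer-size (suc m) (suc i) =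
  All.++⁺ (All.map⁺ (All.map (cong suc) (layer-size m i))) (All.map⁺ (layer-size m (suc i)))

layer-unique : ∀ m i → Unique (layer m i)
layer-unique zero    zero    = [] ∷ []
layer-unique zero    (suc i) = []
layer-unique (suc m) zero    = Unique.map⁺ ∷-injectiveʳ (layer-unique m zero)
layer-unique (suc m) (suc i) = Unique.++⁺
  (Unique.map⁺ ∷-injectiveʳ (layer-unique m i))
  (Unique.map⁺ ∷-injectiveʳ (layer-unique m (suc i)))
  -- The two halves are disjoint because their members differ in the first coordinate.
  (λ (p , q) → case ∈-map⁻ (inside ∷_) p , ∈-map⁻ (outside ∷_) q of
     λ { ((_ , _ , refl) , (_ , _ , ())) })

ball : ∀ m → ℕ → List (Subset m)
ball m t = concatMap (layer m) (upTo (suc t))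

length-concatMap : ∀ {A B : Set} (f : A → List B) {g : A → ℕ} → (∀ x → length (f x) ≡ g x) →
                   ∀ xs → length (concatMap f xs) ≡ sum (map g xs)
length-concatMap f eq []       = refl
length-concatMap f eq (x ∷ xs) =
  trans (length-++ (f x)) (cong₂ ℕ._+_ (eq x) (length-concatMap f eq xs))

length-ball : ∀ m t → length (ball m t) ≡ bound (suc m) t
length-ball m t = length-concatMap (layer m) (length-layer m) (upTo (suc t))

∈-ball⁺ : ∀ (S : Subset m) → ∣ S ∣ ≤ t → S ∈ ball m t
∈-ball⁺ {m} S S≤t = ∈-concatMap⁺ (layer m) (Any.map (λ { refl → ∈-layer⁺ S refl }) (∈-upTo⁺ (s≤s S≤t)))

ball-size : ∀ m t → All (λ S → ∣ S ∣ ≤ t) (ball m t)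
ball-size m t = All.concat⁺ (All.map⁺ (All.map
  (λ {i} i≤t → All.map (λ { refl → ℕ.s≤s⁻¹ i≤t }) (layer-size m i)) (All.all-upTo (suc t))))

ball-unique : ∀ m t → Unique (ball m t)
ball-unique m t = Unique.concat⁺
  (All.map⁺ (All.universal (layer-unique m) (upTo (suc t))))
  (AllPairs.map⁺ (AllPairs.map
    -- Distinct layers are disjoint since a common member would have two sizes.
    (λ i≢j {_} (p , q) → i≢j (trans (sym (All.lookup (layer-size m _) p)) (All.lookup (layer-size m _) q)))
    (Unique.upTo⁺ (suc t))))

-- Completing a set by a parity bit.

parityBit : Parity → Side
parityBit 0ℙ = outside
parityBit 1ℙ = inside

-- The bijection from all subsets of `m` points to the subsets of `suc m` points of parity `p`. It
-- indexes the characters in the upper bound and builds the extremal family.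
withParity : Parity → Subset m → Subset (suc m)
withParity p S = parityBit (p ℙ.+ parity ∣ S ∣) ∷ S

parity-∷ : ∀ q (S : Subset m) → parity ∣ parityBit q ∷ S ∣ ≡ q ℙ.+ parity ∣ S ∣
parity-∷ 0ℙ S = refl
parity-∷ 1ℙ S = parity-suc ∣ S ∣

withParity-parity : ∀ p (S : Subset m) → parity ∣ withParity p S ∣ ≡ p
withParity-parity p S = trans (parity-∷ (p ℙ.+ parity ∣ S ∣) S) (cancel p (parity ∣ S ∣))
  where
  cancel : ∀ p q → p ℙ.+ q ℙ.+ q ≡ p
  cancel p q = trans (ℙ.+-assoc p q q) (trans (cong (p ℙ.+_) (proj₁ ℙ.+-inverse q)) (ℙ.+-identityʳ p))

-- The first bit is determined by the remaining ones and the total parity, so no set of parity `p`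
-- is missed.
withParity-tail : ∀ {p} b (S : Subset m) → parity ∣ b ∷ S ∣ ≡ p → withParity p S ≡ b ∷ S
withParity-tail outside S refl with parity ∣ S ∣
... | 0ℙ = refl
... | 1ℙ = refl
withParity-tail inside  S refl rewrite parity-suc ∣ S ∣ with parity ∣ S ∣
... | 0ℙ = refl
... | 1ℙ = refl

-- Size and parity of symmetric differences.

△-self : (A : Subset n) → ∣ A △ A ∣ ≡ 0
△-self []            = refl
△-self (outside ∷ A) = △-self A
△-self (inside  ∷ A) = △-self A

△-empty⇒≡ : (A B : Subset n) → ∣ A △ B ∣ ≡ 0 → A ≡ B
△-empty⇒≡ []            []            _  = refl
△-empty⇒≡ (outside ∷ A) (outside ∷ B) eq = cong (outside ∷_) (△-empty⇒≡ A B eq)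
△-empty⇒≡ (inside  ∷ A) (inside  ∷ B) eq = cong (inside ∷_) (△-empty⇒≡ A B eq)

∣△∣-≤ : (A B : Subset n) → ∣ A △ B ∣ ≤ ∣ A ∣ ℕ.+ ∣ B ∣
∣△∣-≤ []            []            = z≤n
∣△∣-≤ (outside ∷ A) (outside ∷ B) = ∣△∣-≤ A B
∣△∣-≤ (outside ∷ A) (inside  ∷ B) =
  ℕ.≤-trans (s≤s (∣△∣-≤ A B)) (ℕ.≤-reflexive (sym (ℕ.+-suc ∣ A ∣ ∣ B ∣)))
∣△∣-≤ (inside  ∷ A) (outside ∷ B) = s≤s (∣△∣-≤ A B)
∣△∣-≤ (inside  ∷ A) (inside  ∷ B) =
  ℕ.≤-trans (∣△∣-≤ A B) (ℕ.+-mono-≤ (ℕ.n≤1+n ∣ A ∣) (ℕ.n≤1+n ∣ B ∣))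

∣△∣-∷-≤ : ∀ a b (A B : Subset n) → ∣ (a ∷ A) △ (b ∷ B) ∣ ≤ suc ∣ A △ B ∣
∣△∣-∷-≤ outside outside A B = ℕ.n≤1+n _
∣△∣-∷-≤ outside inside  A B = ℕ.≤-refl
∣△∣-∷-≤ inside  outside A B = ℕ.≤-refl
∣△∣-∷-≤ inside  inside  A B = ℕ.n≤1+n _

⁻¹-+ˡ : ∀ p q → (p ℙ.+ q) ⁻¹ ≡ p ⁻¹ ℙ.+ q
⁻¹-+ˡ 0ℙ q = refl
⁻¹-+ˡ 1ℙ q = ℙ.⁻¹-involutive q

⁻¹-+ʳ : ∀ p q → (p ℙ.+ q) ⁻¹ ≡ p ℙ.+ q ⁻¹
⁻¹-+ʳ 0ℙ q = refl
⁻¹-+ʳ 1ℙ q = refl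

⁻¹-+-⁻¹ : ∀ p q → p ⁻¹ ℙ.+ q ⁻¹ ≡ p ℙ.+ q
⁻¹-+-⁻¹ 0ℙ q = ℙ.⁻¹-involutive q
⁻¹-+-⁻¹ 1ℙ q = refl

-- Each common element is counted twice in the sum of the two sizes and so leaves the parity
-- unchanged.
∣△∣-parity : (A B : Subset n) → parity ∣ A △ B ∣ ≡ parity ∣ A ∣ ℙ.+ parity ∣ B ∣
∣△∣-parity []            []            = refl
∣△∣-parity (outside ∷ A) (outside ∷ B) = ∣△∣-parity A B
∣△∣-parity (outside ∷ A) (inside  ∷ B) = begin
  parity (suc ∣ A △ B ∣)                ≡⟨ parity-suc ∣ A △ B ∣ ⟩
  parity ∣ A △ B ∣ ⁻¹                   ≡⟨ cong _⁻¹ (∣△∣-parity A B) ⟩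
  (parity ∣ A ∣ ℙ.+ parity ∣ B ∣) ⁻¹    ≡⟨ ⁻¹-+ʳ (parity ∣ A ∣) _ ⟩
  parity ∣ A ∣ ℙ.+ parity ∣ B ∣ ⁻¹      ≡⟨ cong (parity ∣ A ∣ ℙ.+_) (parity-suc ∣ B ∣) ⟨
  parity ∣ A ∣ ℙ.+ parity (suc ∣ B ∣)   ∎
  where open ≡-Reasoning
∣△∣-parity (inside  ∷ A) (outside ∷ B) = begin
  parity (suc ∣ A △ B ∣)                ≡⟨ parity-suc ∣ A △ B ∣ ⟩
  parity ∣ A △ B ∣ ⁻¹                   ≡⟨ cong _⁻¹ (∣△∣-parity A B) ⟩
  (parity ∣ A ∣ ℙ.+ parity ∣ B ∣) ⁻¹    ≡⟨ ⁻¹-+ˡ (parity ∣ A ∣) _ ⟩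
  parity ∣ A ∣ ⁻¹ ℙ.+ parity ∣ B ∣      ≡⟨ cong (ℙ._+ parity ∣ B ∣) (parity-suc ∣ A ∣) ⟨
  parity (suc ∣ A ∣) ℙ.+ parity ∣ B ∣   ∎
  where open ≡-Reasoning
∣△∣-parity (inside  ∷ A) (inside  ∷ B) = begin
  parity ∣ A △ B ∣                              ≡⟨ ∣△∣-parity A B ⟩
  parity ∣ A ∣ ℙ.+ parity ∣ B ∣                 ≡⟨ ⁻¹-+-⁻¹ (parity ∣ A ∣) _ ⟨
  parity ∣ A ∣ ⁻¹ ℙ.+ parity ∣ B ∣ ⁻¹           ≡⟨ cong₂ ℙ._+_ (parity-suc ∣ A ∣) (parity-suc ∣ B ∣) ⟨
  parity (suc ∣ A ∣) ℙ.+ parity (suc ∣ B ∣)     ∎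
  where open ≡-Reasoning

even⇒double : ∀ k → parity k ≡ 0ℙ → ∃[ h ] k ≡ 2 ℕ.* h
even⇒double zero          _  = 0 , refl
even⇒double (suc (suc k)) eq with even⇒double k eq
... | h , refl = suc h , sym (ℕ.*-suc 2 h)

-- The upper bound.

monicWithRoots-root : ∀ {a as} → a ∈ as → monicWithRoots as (+ a) ≡ 0ℤ
monicWithRoots-root {a} {_ ∷ as} (here refl) = cong (_* monicWithRoots as (+ a)) (ℤ.+-inverseʳ (+ a))
monicWithRoots-root {a} {b ∷ as} (there a∈as) =
  trans (cong ((+ a - + b) *_) (monicWithRoots-root a∈as)) (ℤ.*-zeroʳ (+ a - + b))

monicWithRoots-pos : ∀ {s} as → All (ℕ._< s) as → 0ℤ ℤ.< monicWithRoots as (+ s)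
monicWithRoots-pos     []       []           = ℤ.+<+ (s≤s z≤n)
monicWithRoots-pos {s} (a ∷ as) (a<s ∷ as<s) =
  subst (ℤ._< (+ s - + a) * p) (ℤ.*-zeroʳ (+ s - + a))
    (ℤ.*-monoˡ-<-pos (+ s - + a) ⦃ ℤ.positive s-a>0 ⦄ (monicWithRoots-pos as as<s))
  where
  p = monicWithRoots as (+ s)
  s-a>0 : 0ℤ ℤ.< + s - + a
  s-a>0 = subst (ℤ._< + s - + a) (ℤ.+-inverseʳ (+ a)) (ℤ.+-monoˡ-< (- + a) (ℤ.+<+ a<s))

annihilated⇒≤bound : (x : Fin r → Subset (suc m)) (as : List ℕ) → length as ≡ t →
  All (ℕ._< suc m) as →
  (∀ i j → j ≢ i → monicWithRoots as (corr (x i) (x j)) ≡ 0ℤ) →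
  r ≤ bound (suc m) t
annihilated⇒≤bound {r} {m} {t} x as refl as<n off = ℕ.≮⇒≥ λ tooMany →
  -- One equation per member of the ball on `m` coordinates, each completed by a bit to the parity
  -- of `t`; the unknowns are indexed by the family.
  let u , (k , uₖ≢0) , ker = kernelVector (subst (ℕ._< r) (sym (length-ball m t)) tooMany)
        (λ e i → χ (withParity (parity t) (lookup (ball m t) e)) (x i))
  in impossible u uₖ≢0 ker
  where
  c = monicWithRoots as (+ suc m)

  corr-self : ∀ (A : Subset (suc m)) → corr A A ≡ + suc m
  corr-self A = trans (corr-△ A A) (trans (cong (λ d → + suc m - + 2 * + d) (△-self A)) (ℤ.+-identityʳ (+ suc m)))

  impossible : (u : Fin r → ℤ) → ∀ {k} → u k ≢ 0ℤ →
    ¬ (∀ e → ∑[ i < r ] (χ (withParity (parity t) (lookup (ball m t) e)) (x i) * u i) ≡ 0ℤ)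
  -- The sign lemma is applied at the empty index set, where its size condition is an equality
  -- because the polynomial has degree `t`.
  impossible u uₖ≢0 ker = ℤ.<⇒≱ c∑u²>0
    (subst (ℤ._≤ 0ℤ) diagonal (twistedForm-nonPos as ⊥ (ℕ.≤-reflexive ⊥+t) (cong parity ⊥+t)))
    where
    orthogonal : ∀ S → ∣ S ∣ ≤ t → parity ∣ S ∣ ≡ parity t → ∑[ i < r ] (χ S (x i) * u i) ≡ 0ℤ
    -- Dropping the first bit lands in the ball, and the parity condition restores that bit, so this
    -- is one of the solved equations.
    orthogonal (b ∷ S) S≤t S≡t =
      subst (λ T → ∑[ i < r ] (χ T (x i) * u i) ≡ 0ℤ)
        (trans (cong (withParity (parity t)) (sym (lookup-index S∈ball))) (withParity-tail b S S≡t))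
        (ker (index S∈ball))
      where
      S∈ball = ∈-ball⁺ S (ℕ.≤-trans (∣p∣≤∣x∷p∣ b S) S≤t)

    open Alternation x u orthogonal
    open QuadraticForm u

    ⊥+t : ∣ ⊥ {suc m} ∣ ℕ.+ t ≡ t
    ⊥+t = cong (ℕ._+ t) (∣⊥∣≡0 (suc m))

    untwisted : ∀ i j → twisted ⊥ as i j ≡ monicWithRoots as (corr (x i) (x j))
    untwisted i j rewrite χ-⊥ (x i) | χ-⊥ (x j) = ℤ.*-identityˡ _

    diagonal : twistedForm ⊥ as ≡ c * ∑[ i < r ] (u i * u i)
    diagonal = form-diagonal
      (λ i → trans (untwisted i i) (cong (monicWithRoots as) (corr-self (x i))))
      (λ i j j≢i → trans (untwisted i j) (off i j j≢i))

    c∑u²>0 : 0ℤ ℤ.< c * ∑[ i < r ] (u i * u i)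
    c∑u²>0 = subst (ℤ._< c * ∑[ i < r ] (u i * u i)) (ℤ.*-zeroʳ c)
      (ℤ.*-monoˡ-<-pos c ⦃ ℤ.positive (monicWithRoots-pos as as<n) ⦄ (∑-squares-pos u uₖ≢0))

-- Lets distinct indices stand for distinct members, as the distance hypothesis requires.
lookup-injective : ∀ {A : Set} {xs : List A} → Unique xs → ∀ i j → lookup xs i ≡ lookup xs j → i ≡ j
lookup-injective (_   ∷ _)   zero    zero    _  = refl
lookup-injective (x∉ ∷ _)    zero    (suc j) eq = contradiction eq (All.lookup x∉ (∈-lookup j))
lookup-injective (x∉ ∷ _)    (suc i) zero    eq = contradiction (sym eq) (All.lookup x∉ (∈-lookup i))
lookup-injective (_   ∷ xs!) (suc i) (suc j) eq = cong suc (lookup-injective xs! i j eq)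

-- 4ℓⱼ ≤ n makes the roots n - 4ℓⱼ nonnegative, and the 1 excludes n = 0.
threshold : (t : ℕ) → (Fin t → ℕ) → ℕ
threshold t ℓ = Extrema.max 1 (tabulate (λ j → 2 ℕ.* (2 ℕ.* ℓ j)))

upperBound : ∀ (ℓ : Fin t → ℕ) → (∀ j → ℓ j > 0) → n ≥ threshold t ℓ →
  (F : Family n) → HasDistances2 ℓ F → card F ≤ bound n t
upperBound {t} {zero} ℓ ℓ>0 n≥n₀ F dist =
  contradiction (ℕ.≤-trans (Extrema.⊥≤max 1 (tabulate (λ j → 2 ℕ.* (2 ℕ.* ℓ j)))) n≥n₀) λ ()
upperBound {t} {n@(suc _)} ℓ ℓ>0 n≥n₀ F dist =
  annihilated⇒≤bound (lookup xs) roots (length-tabulate root)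
    -- Positive distances put every root strictly below `n`, the correlation of a set with itself,
    -- so the diagonal value is positive.
    (All.tabulate⁺ (λ j → ℕ.∸-monoʳ-< (ℕ.*-monoʳ-< 2 (ℕ.*-monoʳ-< 2 (ℓ>0 j))) (4ℓ≤n j)))
    vanishes
  where
  xs = members F

  -- The truncated subtraction is exact by `4ℓ≤n`, so this is the correlation at distance `2 * ℓ j`.
  root : Fin t → ℕ
  root j = n ℕ.∸ 2 ℕ.* (2 ℕ.* ℓ j)

  roots = tabulate root

  4ℓ≤n : ∀ j → 2 ℕ.* (2 ℕ.* ℓ j) ≤ n
  4ℓ≤n j = ℕ.≤-trans (All.tabulate⁻ (Extrema.xs≤max 1 _) j) n≥n₀

  corr-distance : ∀ A B j → ∣ A △ B ∣ ≡ 2 ℕ.* ℓ j → corr A B ≡ + root j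
  corr-distance A B j eq = begin
    corr A B                          ≡⟨ corr-△ A B ⟩
    + n - + 2 * + ∣ A △ B ∣           ≡⟨ cong (λ d → + n - + 2 * + d) eq ⟩
    + n - + 2 * + (2 ℕ.* ℓ j)         ≡⟨ cong (λ d → + n - d) (ℤ.pos-* 2 (2 ℕ.* ℓ j)) ⟨
    + n - + (2 ℕ.* (2 ℕ.* ℓ j))       ≡⟨ ℤ.m-n≡m⊖n n (2 ℕ.* (2 ℕ.* ℓ j)) ⟩
    n ℤ.⊖ (2 ℕ.* (2 ℕ.* ℓ j))         ≡⟨ ℤ.⊖-≥ (4ℓ≤n j) ⟩
    + root j                          ∎
    where open ≡-Reasoning

  vanishes : ∀ i j → j ≢ i → monicWithRoots roots (corr (lookup xs i) (lookup xs j)) ≡ 0ℤ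
  vanishes i j j≢i with dist (lookup xs i) (lookup xs j) (∈-lookup i) (∈-lookup j)
                             (λ eq → j≢i (sym (lookup-injective (unique F) i j eq)))
  ... | k , eq = trans (cong (monicWithRoots roots) (corr-distance (lookup xs i) (lookup xs j) k eq))
                       (monicWithRoots-root (∈-tabulate⁺ k))

-- Sharpness: the ball with a parity bit.

oddBall : ∀ m → ℕ → Family (suc m)
oddBall m t = family (map (withParity 1ℙ) (ball m t)) (Unique.map⁺ ∷-injectiveʳ (ball-unique m t))

oddBall-distances : ∀ m t → HasDistances2 (λ (j : Fin t) → suc (toℕ j)) (oddBall m t)
oddBall-distances m t A B A∈ B∈ A≢B
  with ∈-map⁻ (withParity 1ℙ) A∈ | ∈-map⁻ (withParity 1ℙ) B∈
... | S , S∈ , refl | T , T∈ , refl = index-of (even⇒double _ even)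
  where
  even : parity ∣ A △ B ∣ ≡ 0ℙ
  even = trans (∣△∣-parity A B)
    (cong₂ ℙ._+_ (withParity-parity 1ℙ S) (withParity-parity 1ℙ T))

  -- The parity bit may raise the distance to 2t + 1; evenness then brings it back to at most 2t.
  ∣A△B∣<2[1+t] : ∣ A △ B ∣ ℕ.< 2 ℕ.* suc t
  ∣A△B∣<2[1+t] = begin-strict
    ∣ A △ B ∣               ≤⟨ ∣△∣-∷-≤ (Vec.head A) (Vec.head B) S T ⟩
    suc ∣ S △ T ∣           ≤⟨ s≤s (∣△∣-≤ S T) ⟩
    suc (∣ S ∣ ℕ.+ ∣ T ∣)   ≤⟨ s≤s (ℕ.+-mono-≤ (All.lookup (ball-size m t) S∈) (All.lookup (ball-size m t) T∈)) ⟩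
    suc (t ℕ.+ t)           <⟨ ℕ.n<1+n _ ⟩
    suc (suc (t ℕ.+ t))     ≡⟨ cong suc (ℕ.+-suc t t) ⟨
    suc t ℕ.+ suc t         ≡⟨ cong (suc t ℕ.+_) (ℕ.+-identityʳ (suc t)) ⟨
    2 ℕ.* suc t             ∎
    where open ℕ.≤-Reasoning

  index-of : ∃[ h ] ∣ A △ B ∣ ≡ 2 ℕ.* h → ∃[ j ] ∣ A △ B ∣ ≡ 2 ℕ.* suc (toℕ {t} j)
  index-of (zero  , eq) = contradiction (△-empty⇒≡ A B eq) A≢B
  index-of (suc h , eq) = fromℕ< h<t , trans eq (cong (λ k → 2 ℕ.* suc k) (sym (toℕ-fromℕ< h<t)))
    where
    h<t : h ℕ.< t
    h<t = ℕ.s≤s⁻¹ (ℕ.*-cancelˡ-< 2 _ _ (subst (ℕ._< 2 ℕ.* suc t) eq ∣A△B∣<2[1+t]))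

corollary4p2 : Σ[ n₀ ∈ ((t : ℕ) → (Fin t → ℕ) → ℕ) ]
    ( (∀ (t : ℕ) → t ≥ 1 →
    ∀ (ℓ : Fin t → ℕ) → Injective _≡_ _≡_ ℓ → (∀ j → ℓ j > 0) →
    ∀ (n : ℕ) → n ≥ n₀ t ℓ →
    ∀ (F : Family n) → F ⊆ᶠ OddSubcube → HasDistances2 ℓ F →
    card F ≤ bound n t)
    × (∀ (t : ℕ) → t ≥ 1 →
    ∀ (n : ℕ) → n ≥ n₀ t (λ j → suc (toℕ j)) →
    ∃[ F ] (F ⊆ᶠ OddSubcube × HasDistances2 {n = n} (λ (j : Fin t) → suc (toℕ j)) F
    × card F ≡ bound n t)) )
corollary4p2 = threshold ,
  (λ t _ ℓ _ ℓ>0 n n≥n₀ F _ dist → upperBound ℓ ℓ>0 n≥n₀ F dist) ,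
  λ { t _ zero n≥n₀ →
        contradiction (ℕ.≤-trans (Extrema.⊥≤max 1 (tabulate {n = t} _)) n≥n₀) λ ()
    ; t _ (suc m) _ → oddBall m t
        , All.map⁺ (All.universal (withParity-parity 1ℙ) (ball m t))
        , oddBall-distances m t
        , trans (length-map (withParity 1ℙ) (ball m t)) (length-ball m t) }
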